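{- If $R$ is a unital archimedean $\ell u$-ring and $G$ is an archimedean $\ell u$-group, then $R\otimes_a G$ is an $\ell u$-module over $R$.
   Context: An $\ell u$-group is an abelian lattice-ordered group with a strong unit. An $\ell u$-ring is a lattice-ordered ring whose additive $\ell$-group has a strong unit; unital means it has a multiplicative unit, which is required to coincide with the strong unit. An $\ell u$-module over $R$ is a lattice-ordered $R$-module (positive scalars act by $\ell$-group endomorphisms and $R^+M^+\subseteq M^+$) with a strong unit. Archimedean: $nx\le y$ for all $n\in\mathbb N$ implies $x\le 0$. For archimedean $\ell$-groups $G,H$, $G\otimes_a H$ denotes the archimedean tensor product (Fremlin; Buskes–van Rooij): the archimedean $\ell$-group with an $\ell$-bilinear map $G\times H\to G\otimes_a H$ (an $\ell$-group homomorphism in each argument when the other is positive) universal among $\ell$-bilinear maps into archimedean $\ell$-groups; here $R\otimes_a G$ refers to the additive $\ell$-group of $R$. -}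

module Defs where

open import Level using (Level; _⊔_) renaming (suc to lsuc)
open import Data.Nat using (ℕ; zero; suc)
open import Data.Product using (Σ; ∃; _×_; _,_)
open import Relation.Binary.Core using (Rel)
open import Algebra.Core using (Op₁; Op₂)
open import Algebra.Structures using (IsAbelianGroup; IsRing)
open import Algebra.Lattice.Structures using (IsLattice)
open import Algebra.Bundles using (Ring)
open import Algebra.Module.Structures using (IsLeftModule)

record LGroup (c ℓ : Level) : Set (lsuc (c ⊔ ℓ)) where
  infixl 6 _+_
  infixr 7 _∨_ _∧_
  infix 4 _≈_ _≤_
  field
    Carrier         : Set c
    _≈_             : Rel Carrier ℓ
    _+_             : Op₂ Carrier
    0#              : Carrier
    -_              : Op₁ Carrier
    _∨_             : Op₂ Carrier
    _∧_             : Op₂ Carrier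
    isAbelianGroup  : IsAbelianGroup _≈_ _+_ 0# -_
    isLattice       : IsLattice _≈_ _∨_ _∧_
    +-distribˡ-∨    : ∀ x y z → (x + (y ∨ z)) ≈ ((x + y) ∨ (x + z))

  _≤_ : Rel Carrier ℓ
  x ≤ y = (x ∨ y) ≈ y

  _·ℕ_ : ℕ → Carrier → Carrier
  zero  ·ℕ x = 0#
  suc n ·ℕ x = x + (n ·ℕ x)

module _ {c ℓ} (G : LGroup c ℓ) where
  open LGroup G

  IsStrongUnit : Carrier → Set (c ⊔ ℓ)
  IsStrongUnit u = (0# ≤ u) × (∀ x → ∃ λ (n : ℕ) → x ≤ (n ·ℕ u))

  Archimedean : Set (c ⊔ ℓ)
  Archimedean = ∀ x y → (∀ (n : ℕ) → (n ·ℕ x) ≤ y) → x ≤ 0#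

record IsLHom {a ℓa b ℓb} (G : LGroup a ℓa) (H : LGroup b ℓb)
              (f : LGroup.Carrier G → LGroup.Carrier H) : Set (a ⊔ ℓa ⊔ ℓb) where
  private
    module G = LGroup G
    module H = LGroup H
  field
    cong   : ∀ {x y} → x G.≈ y → f x H.≈ f y
    hom-+  : ∀ x y → f (x G.+ y) H.≈ (f x H.+ f y)
    hom-∨  : ∀ x y → f (x G.∨ y) H.≈ (f x H.∨ f y)
    hom-∧  : ∀ x y → f (x G.∧ y) H.≈ (f x H.∧ f y)

record IsLBilinear {a ℓa b ℓb c ℓc} (G : LGroup a ℓa) (H : LGroup b ℓb) (K : LGroup c ℓc)
                   (β : LGroup.Carrier G → LGroup.Carrier H → LGroup.Carrier K)
                   : Set (a ⊔ ℓa ⊔ b ⊔ ℓb ⊔ c ⊔ ℓc) where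
  private
    module G = LGroup G
    module H = LGroup H
    module K = LGroup K
  field
    cong        : ∀ {x x' y y'} → x G.≈ x' → y H.≈ y' → β x y K.≈ β x' y'
    additiveˡ   : ∀ x x' y → β (x G.+ x') y K.≈ (β x y K.+ β x' y)
    additiveʳ   : ∀ x y y' → β x (y H.+ y') K.≈ (β x y K.+ β x y')
    latticeˡ    : ∀ y → H.0# H.≤ y → IsLHom G K (λ x → β x y)
    latticeʳ    : ∀ x → G.0# G.≤ x → IsLHom H K (λ y → β x y)

-- The archimedean tensor product G ⊗_a H (Fremlin; Buskes–van Rooij),
-- given by its universal property among ℓ-bilinear maps into archimedean
-- ℓ-groups (of the same universe levels).

record ArchTensor {c ℓ} (G H : LGroup c ℓ) : Set (lsuc (c ⊔ ℓ)) where
  field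
    T            : LGroup c ℓ
    T-archimedean : Archimedean T
    _⊗_          : LGroup.Carrier G → LGroup.Carrier H → LGroup.Carrier T
    ⊗-bilinear   : IsLBilinear G H T _⊗_
    universal    : ∀ (K : LGroup c ℓ) → Archimedean K →
                   ∀ (β : LGroup.Carrier G → LGroup.Carrier H → LGroup.Carrier K) →
                   IsLBilinear G H K β →
                   Σ (LGroup.Carrier T → LGroup.Carrier K) λ φ →
                     IsLHom T K φ ×
                     (∀ x y → LGroup._≈_ K (φ (x ⊗ y)) (β x y)) ×
                     (∀ (ψ : LGroup.Carrier T → LGroup.Carrier K) → IsLHom T K ψ →
                        (∀ x y → LGroup._≈_ K (ψ (x ⊗ y)) (β x y)) →
                        ∀ t → LGroup._≈_ K (ψ t) (φ t))

record LRing (c ℓ : Level) : Set (lsuc (c ⊔ ℓ)) where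
  infixl 7 _*_
  infixl 6 _+_
  infixr 7 _∨_ _∧_
  infix 4 _≈_
  field
    Carrier        : Set c
    _≈_            : Rel Carrier ℓ
    _+_            : Op₂ Carrier
    _*_            : Op₂ Carrier
    -_             : Op₁ Carrier
    0#             : Carrier
    1#             : Carrier
    _∨_            : Op₂ Carrier
    _∧_            : Op₂ Carrier
    isRing         : IsRing _≈_ _+_ _*_ -_ 0# 1#
    isLattice      : IsLattice _≈_ _∨_ _∧_
    +-distribˡ-∨   : ∀ x y z → (x + (y ∨ z)) ≈ ((x + y) ∨ (x + z))
    *-positive     : ∀ x y → (0# ∨ x) ≈ x → (0# ∨ y) ≈ y → (0# ∨ (x * y)) ≈ (x * y)

  ring : Ring c ℓ
  ring = record { isRing = isRing }

  additive : LGroup c ℓ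
  additive = record
    { isAbelianGroup = IsRing.+-isAbelianGroup isRing
    ; isLattice = isLattice
    ; +-distribˡ-∨ = +-distribˡ-∨
    }

IsUnitalLURing : ∀ {c ℓ} → LRing c ℓ → Set (c ⊔ ℓ)
IsUnitalLURing R = IsStrongUnit (LRing.additive R) (LRing.1# R)

record IsLUModule {c ℓ m ℓm} (R : LRing c ℓ) (M : LGroup m ℓm)
                  (_·_ : LRing.Carrier R → LGroup.Carrier M → LGroup.Carrier M)
                  : Set (c ⊔ ℓ ⊔ m ⊔ ℓm) where
  private
    module R = LRing R
    module RG = LGroup R.additive
    module M = LGroup M
  field
    isLeftModule   : IsLeftModule R.ring M._≈_ M._+_ M.0# M.-_ _·_
    positive-∨     : ∀ r → RG.0# RG.≤ r → ∀ x y → (r · (x M.∨ y)) M.≈ ((r · x) M.∨ (r · y))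
    positive-∧     : ∀ r → RG.0# RG.≤ r → ∀ x y → (r · (x M.∧ y)) M.≈ ((r · x) M.∧ (r · y))
    positive-cone  : ∀ r x → RG.0# RG.≤ r → M.0# M.≤ x → M.0# M.≤ (r · x)
    strongUnit     : ∃ λ (e : LGroup.Carrier M) → IsStrongUnit M e

{-# OPTIONS --safe #-}
-- For a ≥ 0 multiplication by a preserves disjointness in R, because a ≤ n·1; hence
-- (s , g) ↦ as ⊗ g is ℓ-bilinear and induces an ℓ-endomorphism φ_a of T = R ⊗ₐ G.  Everything
-- hinges on φ_{r+s} = φ_r + φ_s, which is not clear because a sum of ℓ-homomorphisms need not
-- be one.  Since T is generated by the tensors as an ℓ-group, every t satisfies a Lipschitz
-- estimate |φ_r t − φ_s t| ≤ |r − s| ⊗ g with g independent of r and s.  Comparing mr and ms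
-- with integer multiples of 1, on which φ is additive, gives
--   m |φ_{r+s} t − φ_r t − φ_s t| ≤ (|mr − i| + |ms − j|) ⊗ 2g    for all i, j ∈ ℕ,
-- and since the infimum over i of |mr − i| is at most 1, the left side is bounded
-- independently of m; T being archimedean, it vanishes.  Then r · t = φ_{r⁺} t − φ_{r⁻} t is
-- a module structure, and the estimate for r = 1, s = 0 shows that 1 ⊗ u is a strong unit.
module Submission where

open import Defs
open import Level using (_⊔_)
open import Data.Nat using (ℕ; zero; suc)
import Data.Nat as ℕ
open import Data.Product using (Σ; ∃; _×_; _,_; proj₁; proj₂)
open import Algebra.Bundles using (AbelianGroup; Ring)
open import Algebra.Lattice.Bundles using (Lattice)
open import Algebra.Structures using (IsAbelianGroup)
open import Algebra.Lattice.Structures using (IsLattice)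
open import Relation.Binary.Bundles using (Poset)
open import Relation.Binary.Structures using (IsEquivalence)
open import Algebra.Module.Structures using (IsLeftModule)
import Algebra.Lattice.Properties.Lattice
import Algebra.Properties.AbelianGroup
import Algebra.Properties.CommutativeSemigroup
import Relation.Binary.Reasoning.PartialOrder

-- Arithmetic and order in abelian ℓ-groups.

module LGroupProperties {c ℓ} (G : LGroup c ℓ) where
  open LGroup G public
  open IsLattice isLattice public
    using (∨-comm; ∨-assoc; ∨-cong; ∧-comm; ∧-assoc; ∧-cong; ∨-absorbs-∧; ∧-absorbs-∨)
  open IsAbelianGroup isAbelianGroup public
    using (refl; sym; trans)
    renaming (assoc to +-assoc; comm to +-comm; ∙-cong to +-cong; ∙-congˡ to +-congˡ;
              ∙-congʳ to +-congʳ; identityˡ to +-identityˡ; identityʳ to +-identityʳ;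
              inverseˡ to -‿inverseˡ; inverseʳ to -‿inverseʳ; ⁻¹-cong to -‿cong;
              isEquivalence to ≈-isEquivalence)

  abelianGroup : AbelianGroup c ℓ
  abelianGroup = record { isAbelianGroup = isAbelianGroup }

  lattice : Lattice c ℓ
  lattice = record { isLattice = isLattice }

  private
    module L = Algebra.Lattice.Properties.Lattice lattice
    module A = Algebra.Properties.AbelianGroup abelianGroup
  open Algebra.Properties.CommutativeSemigroup (AbelianGroup.commutativeSemigroup abelianGroup) public
    using () renaming (interchange to +-interchange; xy∙z≈xz∙y to xy+z≈xz+y)

  ≤-trans : ∀ {x y z} → x ≤ y → y ≤ z → x ≤ z
  ≤-trans {x} {y} {z} p q =
    trans (∨-cong refl (sym q)) (trans (sym (∨-assoc x y z)) (trans (∨-cong p refl) q))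

  ≤-antisym : ∀ {x y} → x ≤ y → y ≤ x → x ≈ y
  ≤-antisym {x} {y} p q = trans (sym q) (trans (∨-comm y x) p)

  ≤-reflexive : ∀ {x y} → x ≈ y → x ≤ y
  ≤-reflexive {x} {y} p = trans (∨-cong p refl) (L.∨-idem y)

  ≤-refl : ∀ {x} → x ≤ x
  ≤-refl = ≤-reflexive refl

  poset : Poset c ℓ ℓ
  poset = record
    { isPartialOrder = record
      { isPreorder = record
        { isEquivalence = ≈-isEquivalence ; reflexive = ≤-reflexive ; trans = ≤-trans }
      ; antisym = ≤-antisym } }

  module ≤-Reasoning = Relation.Binary.Reasoning.PartialOrder poset
  open ≤-Reasoning

  x≤x∨y : ∀ x y → x ≤ x ∨ y
  x≤x∨y x y = trans (sym (∨-assoc x x y)) (∨-cong (L.∨-idem x) refl)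

  y≤x∨y : ∀ x y → y ≤ x ∨ y
  y≤x∨y x y = ≤-trans (x≤x∨y y x) (≤-reflexive (∨-comm y x))

  ∨-least : ∀ {x y z} → x ≤ z → y ≤ z → x ∨ y ≤ z
  ∨-least {x} {y} {z} p q = trans (∨-assoc x y z) (trans (∨-cong refl q) p)

  x∧y≤x : ∀ x y → x ∧ y ≤ x
  x∧y≤x x y = trans (∨-comm (x ∧ y) x) (∨-absorbs-∧ x y)

  x∧y≤y : ∀ x y → x ∧ y ≤ y
  x∧y≤y x y = ≤-trans (≤-reflexive (∧-comm x y)) (x∧y≤x y x)

  ≤⇒∧ : ∀ {x y} → x ≤ y → x ∧ y ≈ x
  ≤⇒∧ {x} {y} p = trans (∧-cong refl (sym p)) (∧-absorbs-∨ x y)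

  ∧⇒≤ : ∀ {x y} → x ∧ y ≈ x → x ≤ y
  ∧⇒≤ {x} {y} p = ≤-trans (≤-reflexive (sym p)) (x∧y≤y x y)

  ∧-greatest : ∀ {x y z} → z ≤ x → z ≤ y → z ≤ x ∧ y
  ∧-greatest {x} {y} {z} p q = ∧⇒≤
    (trans (sym (∧-assoc z x y)) (trans (∧-cong (≤⇒∧ p) refl) (≤⇒∧ q)))

  +-monoʳ-≤ : ∀ z {x y} → x ≤ y → z + x ≤ z + y
  +-monoʳ-≤ z {x} {y} p = trans (sym (+-distribˡ-∨ z x y)) (+-congˡ p)

  +-monoˡ-≤ : ∀ z {x y} → x ≤ y → x + z ≤ y + z
  +-monoˡ-≤ z {x} {y} p = begin
    x + z ≈⟨ +-comm x z ⟩
    z + x ≤⟨ +-monoʳ-≤ z p ⟩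
    z + y ≈⟨ +-comm z y ⟩
    y + z ∎

  +-mono-≤ : ∀ {x y u v} → x ≤ y → u ≤ v → x + u ≤ y + v
  +-mono-≤ {x} {y} {u} {v} p q = ≤-trans (+-monoˡ-≤ u p) (+-monoʳ-≤ y q)

  x-y+y≈x : ∀ x y → (x + - y) + y ≈ x
  x-y+y≈x x y = trans (+-assoc x (- y) y) (trans (+-congˡ (-‿inverseˡ y)) (+-identityʳ x))

  x+y-y≈x : ∀ x y → (x + y) + - y ≈ x
  x+y-y≈x x y = trans (+-assoc x y (- y)) (trans (+-congˡ (-‿inverseʳ y)) (+-identityʳ x))

  +-cancelʳ-≤ : ∀ z {x y} → x + z ≤ y + z → x ≤ y
  +-cancelʳ-≤ z {x} {y} p = begin
    x             ≈⟨ x+y-y≈x x z ⟨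
    (x + z) + - z ≤⟨ +-monoˡ-≤ (- z) p ⟩
    (y + z) + - z ≈⟨ x+y-y≈x y z ⟩
    y             ∎

  +-cancelʳ : ∀ z {x y} → x + z ≈ y + z → x ≈ y
  +-cancelʳ z p = ≤-antisym (+-cancelʳ-≤ z (≤-reflexive p)) (+-cancelʳ-≤ z (≤-reflexive (sym p)))

  x≤y+z⇒x-z≤y : ∀ {x y z} → x ≤ y + z → x + - z ≤ y
  x≤y+z⇒x-z≤y {x} {y} {z} p = ≤-trans (+-monoˡ-≤ (- z) p) (≤-reflexive (x+y-y≈x y z))

  x-z≤y⇒x≤y+z : ∀ {x y z} → x + - z ≤ y → x ≤ y + z
  x-z≤y⇒x≤y+z {x} {y} {z} p = ≤-trans (≤-reflexive (sym (x-y+y≈x x z))) (+-monoˡ-≤ z p)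

  x+z≤y⇒x≤y-z : ∀ {x y z} → x + z ≤ y → x ≤ y + - z
  x+z≤y⇒x≤y-z {x} {y} {z} p = ≤-trans (≤-reflexive (sym (x+y-y≈x x z))) (+-monoˡ-≤ (- z) p)

  x≤y⇒0≤y-x : ∀ {x y} → x ≤ y → 0# ≤ y + - x
  x≤y⇒0≤y-x p = x+z≤y⇒x≤y-z (≤-trans (≤-reflexive (+-identityˡ _)) p)

  neg-antimono : ∀ {x y} → x ≤ y → - y ≤ - x
  neg-antimono {x} {y} p = begin
    - y             ≈⟨ +-identityˡ _ ⟨
    0# + - y        ≈⟨ +-congʳ (-‿inverseˡ x) ⟨
    (- x + x) + - y ≤⟨ +-monoˡ-≤ (- y) (+-monoʳ-≤ (- x) p) ⟩
    (- x + y) + - y ≈⟨ x+y-y≈x (- x) y ⟩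
    - x             ∎

  neg-cancel-≤ : ∀ {x y} → - x ≤ - y → y ≤ x
  neg-cancel-≤ {x} {y} p = begin
    y       ≈⟨ A.⁻¹-involutive y ⟨
    - (- y) ≤⟨ neg-antimono p ⟩
    - (- x) ≈⟨ A.⁻¹-involutive x ⟩
    x       ∎

  neg-+ : ∀ x y → - x + - y ≈ - (x + y)
  neg-+ = A.⁻¹-∙-comm

  x≤x+y : ∀ x {y} → 0# ≤ y → x ≤ x + y
  x≤x+y x p = ≤-trans (≤-reflexive (sym (+-identityʳ x))) (+-monoʳ-≤ x p)

  x≤y+x : ∀ x {y} → 0# ≤ y → x ≤ y + x
  x≤y+x x p = ≤-trans (≤-reflexive (sym (+-identityˡ x))) (+-monoˡ-≤ x p)

  +-nonneg : ∀ {x y} → 0# ≤ x → 0# ≤ y → 0# ≤ x + y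
  +-nonneg {x} p q = ≤-trans p (x≤x+y x q)

  -- Translation is an order isomorphism: subtracting `x` from the right-hand meet gives a lower
  -- bound of `y` and `z`.
  +-distribˡ-∧ : ∀ x y z → x + (y ∧ z) ≈ (x + y) ∧ (x + z)
  +-distribˡ-∧ x y z = ≤-antisym
    (∧-greatest (+-monoʳ-≤ x (x∧y≤x y z)) (+-monoʳ-≤ x (x∧y≤y y z)))
    (begin
      m               ≈⟨ x-y+y≈x m x ⟨
      (m + - x) + x   ≤⟨ +-monoˡ-≤ x (∧-greatest (shift (x∧y≤x _ _)) (shift (x∧y≤y _ _))) ⟩
      (y ∧ z) + x     ≈⟨ +-comm _ x ⟩
      x + (y ∧ z)     ∎)
    where
    m = (x + y) ∧ (x + z)
    shift : ∀ {v} → m ≤ x + v → m + - x ≤ v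
    shift p = x≤y+z⇒x-z≤y (≤-trans p (≤-reflexive (+-comm x _)))

  ∨+∧ : ∀ x y → (x ∨ y) + (x ∧ y) ≈ x + y
  ∨+∧ x y = ≤-antisym
    (≤-trans (≤-reflexive (+-comm _ _)) (≤-trans (≤-reflexive (+-distribˡ-∨ (x ∧ y) x y))
      (∨-least (≤-trans (+-monoˡ-≤ x (x∧y≤y x y)) (≤-reflexive (+-comm y x)))
               (+-monoˡ-≤ y (x∧y≤x x y)))))
    (≤-trans (∧-greatest (≤-trans (≤-reflexive (+-comm x y)) (+-monoˡ-≤ x (y≤x∨y x y)))
                         (+-monoˡ-≤ y (x≤x∨y x y)))
             (≤-reflexive (sym (+-distribˡ-∧ (x ∨ y) x y))))

  ·ℕ-cong : ∀ n {x y} → x ≈ y → n ·ℕ x ≈ n ·ℕ y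
  ·ℕ-cong zero    p = refl
  ·ℕ-cong (suc n) p = +-cong p (·ℕ-cong n p)

  ·ℕ-distrib-+ : ∀ n x y → n ·ℕ (x + y) ≈ n ·ℕ x + n ·ℕ y
  ·ℕ-distrib-+ zero    x y = sym (+-identityˡ 0#)
  ·ℕ-distrib-+ (suc n) x y = trans (+-congˡ (·ℕ-distrib-+ n x y)) (+-interchange x y _ _)

  ·ℕ-homo-+ : ∀ m n x → (m ℕ.+ n) ·ℕ x ≈ m ·ℕ x + n ·ℕ x
  ·ℕ-homo-+ zero    n x = sym (+-identityˡ _)
  ·ℕ-homo-+ (suc m) n x = trans (+-congˡ (·ℕ-homo-+ m n x)) (sym (+-assoc x _ _))

  ·ℕ-nonneg : ∀ n {x} → 0# ≤ x → 0# ≤ n ·ℕ x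
  ·ℕ-nonneg zero    p = ≤-refl
  ·ℕ-nonneg (suc n) p = +-nonneg p (·ℕ-nonneg n p)

  -- Induction on `n`: whatever lies below `x + n x` and `y` lies below both `n x + x` and
  -- `n x + y`, hence below `n x + (x ∧ y) ≤ n x`, so it is already below `n x ∧ y`.
  disjoint-·ℕˡ : ∀ n {x y} → 0# ≤ x → x ∧ y ≤ 0# → (n ·ℕ x) ∧ y ≤ 0#
  disjoint-·ℕˡ zero    p d = x∧y≤x _ _
  disjoint-·ℕˡ (suc n) {x} {y} p d = ≤-trans (∧-greatest step (x∧y≤y _ y)) (disjoint-·ℕˡ n p d)
    where
    z = (suc n ·ℕ x) ∧ y
    step : z ≤ n ·ℕ x
    step = begin
      z                              ≤⟨ ∧-greatest
                                          (≤-trans (x∧y≤x _ y) (≤-reflexive (+-comm x _)))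
                                          (≤-trans (x∧y≤y _ y) (x≤y+x y (·ℕ-nonneg n p))) ⟩
      (n ·ℕ x + x) ∧ (n ·ℕ x + y)    ≈⟨ +-distribˡ-∧ (n ·ℕ x) x y ⟨
      n ·ℕ x + (x ∧ y)               ≤⟨ +-monoʳ-≤ _ d ⟩
      n ·ℕ x + 0#                    ≈⟨ +-identityʳ _ ⟩
      n ·ℕ x                         ∎

  disjoint-·ℕ : ∀ n {x y} → 0# ≤ x → 0# ≤ y → x ∧ y ≤ 0# → (n ·ℕ x) ∧ (n ·ℕ y) ≤ 0#
  disjoint-·ℕ n {x} {y} p q d = ≤-trans (≤-reflexive (∧-comm _ _))
    (disjoint-·ℕˡ n q (≤-trans (≤-reflexive (∧-comm y _)) (disjoint-·ℕˡ n p d)))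

  pos neg : Carrier → Carrier
  pos x = x ∨ 0#
  neg x = - x ∨ 0#

  pos-nonneg : ∀ x → 0# ≤ pos x
  pos-nonneg x = y≤x∨y x 0#

  neg-nonneg : ∀ x → 0# ≤ neg x
  neg-nonneg x = y≤x∨y (- x) 0#

  x+neg≈pos : ∀ x → x + neg x ≈ pos x
  x+neg≈pos x = trans (+-distribˡ-∨ x (- x) 0#)
    (trans (∨-cong (-‿inverseʳ x) (+-identityʳ x)) (∨-comm 0# x))

  pos-of-nonneg : ∀ {x} → 0# ≤ x → pos x ≈ x
  pos-of-nonneg {x} p = trans (∨-comm x 0#) p

  -- This is |x - y|; in this form its defining subtraction can be cancelled against `x ∧ y`.
  dist : Carrier → Carrier → Carrier
  dist x y = (x ∨ y) + - (x ∧ y)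

  dist-nonneg : ∀ x y → 0# ≤ dist x y
  dist-nonneg x y = x≤y⇒0≤y-x (≤-trans (x∧y≤x x y) (x≤x∨y x y))

  x≤y+dist : ∀ x y → x ≤ y + dist x y
  x≤y+dist x y = begin
    x                     ≤⟨ x≤x∨y x y ⟩
    x ∨ y                 ≈⟨ x-y+y≈x _ _ ⟨
    dist x y + (x ∧ y)    ≤⟨ +-monoʳ-≤ _ (x∧y≤y x y) ⟩
    dist x y + y          ≈⟨ +-comm _ y ⟩
    y + dist x y          ∎

  y≤x+dist : ∀ x y → y ≤ x + dist x y
  y≤x+dist x y = begin
    y                     ≤⟨ y≤x∨y x y ⟩
    x ∨ y                 ≈⟨ x-y+y≈x _ _ ⟨
    dist x y + (x ∧ y)    ≤⟨ +-monoʳ-≤ _ (x∧y≤x x y) ⟩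
    dist x y + x          ≈⟨ +-comm _ x ⟩
    x + dist x y          ∎

  -- With y = x − k: q ≤ y ∨ e and q ≤ |y − e| imply q ≤ (y − e) ∨ e, with the
  -- subtractions moved to the other side.
  grid-step : ∀ {e k x q} → 0# ≤ e →
    q + k ≤ x ∨ (e + k) → q + (x ∧ (e + k)) ≤ x ∨ (e + k) →
    q + (e + k) ≤ x ∨ (e + (e + k))
  grid-step {e} {k} {x} {q} 0≤e h₁ h₂ = +-cancelʳ-≤ b (begin
    (q + f) + b          ≈⟨ trans (+-assoc q f b) (trans (+-congˡ (+-comm f b)) (sym (+-assoc q b f))) ⟩
    (q + b) + f          ≤⟨ +-monoˡ-≤ f qb≤ ⟩
    (x ∨ f) + f          ≈⟨ trans (+-comm _ f) (+-distribˡ-∨ f x f) ⟩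
    (f + x) ∨ (f + f)    ≤⟨ ∨-least case-x case-f ⟩
    t + b                ∎)
    where
    f = e + k
    -- Adding `b` to `q` merges both hypotheses: `q + b` is the join of their left-hand sides.
    b = k ∨ (x ∧ f)
    t = x ∨ (e + f)
    qb≤ : q + b ≤ x ∨ f
    qb≤ = ≤-trans (≤-reflexive (+-distribˡ-∨ q k (x ∧ f))) (∨-least h₁ h₂)
    case-f : f + f ≤ t + b
    case-f = begin
      f + (e + k) ≈⟨ +-assoc f e k ⟨
      (f + e) + k ≈⟨ +-congʳ (+-comm f e) ⟩
      (e + f) + k ≤⟨ +-mono-≤ (y≤x∨y x _) (x≤x∨y k _) ⟩
      t + b       ∎
    case-x : f + x ≤ t + b
    case-x = begin
      f + x               ≤⟨ ∧-greatest
                               (+-monoˡ-≤ x (≤-trans (x≤y+x f 0≤e) (y≤x∨y x _)))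
                               (≤-trans (+-monoʳ-≤ f (x≤x∨y x _)) (≤-reflexive (+-comm f t))) ⟩
      (t + x) ∧ (t + f)   ≈⟨ +-distribˡ-∧ t x f ⟨
      t + (x ∧ f)         ≤⟨ +-monoʳ-≤ t (y≤x∨y k _) ⟩
      t + b               ∎

-- Additive maps and ℓ-homomorphisms.

module _ {a ℓa b ℓb} (G : LGroup a ℓa) (H : LGroup b ℓb) where
  private
    module G = LGroupProperties G
    module H = LGroupProperties H

  module AdditiveMap {f : G.Carrier → H.Carrier}
    (f-cong : ∀ {x y} → x G.≈ y → f x H.≈ f y)
    (f-+ : ∀ x y → f (x G.+ y) H.≈ (f x H.+ f y)) where

    f-0 : f G.0# H.≈ H.0#
    f-0 = H.+-cancelʳ (f G.0#)
      (H.trans (H.sym (f-+ _ _)) (H.trans (f-cong (G.+-identityˡ _)) (H.sym (H.+-identityˡ _))))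

    f-neg : ∀ x → f (G.- x) H.≈ H.- f x
    f-neg x = H.+-cancelʳ (f x) (H.trans (H.sym (f-+ _ _))
      (H.trans (f-cong (G.-‿inverseˡ x)) (H.trans f-0 (H.sym (H.-‿inverseˡ _)))))

    f-·ℕ : ∀ n x → f (n G.·ℕ x) H.≈ n H.·ℕ f x
    f-·ℕ zero    x = f-0
    f-·ℕ (suc n) x = H.trans (f-+ _ _) (H.+-congˡ (f-·ℕ n x))

    module _ (f-nonneg : ∀ {x} → G.0# G.≤ x → H.0# H.≤ f x) where
      f-mono : ∀ {x y} → x G.≤ y → f x H.≤ f y
      f-mono {x} {y} p = H.≤-trans (H.x≤y+x (f x) (f-nonneg (G.x≤y⇒0≤y-x p)))
        (H.≤-reflexive (H.trans (H.sym (f-+ _ _)) (f-cong (G.x-y+y≈x y x))))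

      module _ (f-disjoint : ∀ {x y} → G.0# G.≤ x → G.0# G.≤ y → x G.∧ y G.≤ G.0# →
                             f x H.∧ f y H.≤ H.0#) where

        -- Subtracting x ∧ y from x and y makes them disjoint.
        preserves-∧ : ∀ x y → f (x G.∧ y) H.≈ f x H.∧ f y
        preserves-∧ x y = H.≤-antisym
          (H.∧-greatest (f-mono (G.x∧y≤x x y)) (f-mono (G.x∧y≤y x y)))
          (begin
            f x H.∧ f y
              ≈⟨ H.∧-cong (split x) (split y) ⟩
            (f m H.+ f x′) H.∧ (f m H.+ f y′)
              ≈⟨ H.+-distribˡ-∧ (f m) (f x′) (f y′) ⟨
            f m H.+ (f x′ H.∧ f y′)
              ≤⟨ H.+-monoʳ-≤ (f m) (f-disjoint (G.x≤y⇒0≤y-x (G.x∧y≤x x y))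
                   (G.x≤y⇒0≤y-x (G.x∧y≤y x y)) disjoint) ⟩
            f m H.+ H.0#
              ≈⟨ H.+-identityʳ _ ⟩
            f m ∎)
          where
          open H.≤-Reasoning
          m = x G.∧ y
          x′ = x G.+ G.- m
          y′ = y G.+ G.- m
          split : ∀ z → f z H.≈ f m H.+ f (z G.+ G.- m)
          split z = H.trans (f-cong (G.sym (G.trans (G.+-comm _ _) (G.x-y+y≈x z m)))) (f-+ _ _)
          disjoint : x′ G.∧ y′ G.≤ G.0#
          disjoint = G.≤-reflexive (G.trans (G.∧-cong (G.+-comm _ _) (G.+-comm _ _))
            (G.trans (G.sym (G.+-distribˡ-∧ _ _ _)) (G.-‿inverseˡ m)))

        -- Joins follow from meets: `f` preserves the sum in `(x ∨ y) + (x ∧ y) ≈ x + y`, and the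
        -- meet terms cancel.
        isLHom : IsLHom G H f
        isLHom = record
          { cong = f-cong
          ; hom-+ = f-+
          ; hom-∨ = λ x y → H.+-cancelʳ (f (x G.∧ y))
              (H.trans (H.sym (f-+ _ _)) (H.trans (f-cong (G.∨+∧ x y)) (H.trans (f-+ x y)
                (H.trans (H.sym (H.∨+∧ (f x) (f y))) (H.+-congˡ (H.sym (preserves-∧ x y)))))))
          ; hom-∧ = preserves-∧
          }

  module LHom {f : G.Carrier → H.Carrier} (f-hom : IsLHom G H f) where
    open IsLHom f-hom public
    open AdditiveMap cong hom-+ public using () renaming (f-0 to hom-0; f-neg to hom-neg; f-·ℕ to hom-·ℕ)

    hom-mono : ∀ {x y} → x G.≤ y → f x H.≤ f y
    hom-mono p = H.trans (H.sym (hom-∨ _ _)) (cong p)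

    hom-nonneg : ∀ {x} → G.0# G.≤ x → H.0# H.≤ f x
    hom-nonneg p = H.≤-trans (H.≤-reflexive (H.sym hom-0)) (hom-mono p)

module _ {a ℓa b ℓb c ℓc} {G : LGroup a ℓa} {H : LGroup b ℓb} {K : LGroup c ℓc} where
  private
    module K = LGroup K

  ∘-isLHom : ∀ {f g} → IsLHom H K g → IsLHom G H f → IsLHom G K (λ x → g (f x))
  ∘-isLHom {f} {g} g-hom f-hom = record
    { cong  = λ p → g.cong (f.cong p)
    ; hom-+ = λ x y → trans (g.cong (f.hom-+ x y)) (g.hom-+ _ _)
    ; hom-∨ = λ x y → trans (g.cong (f.hom-∨ x y)) (g.hom-∨ _ _)
    ; hom-∧ = λ x y → trans (g.cong (f.hom-∧ x y)) (g.hom-∧ _ _)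
    }
    where
    module f = IsLHom f-hom
    module g = IsLHom g-hom
    open LGroupProperties K using (trans)

id-isLHom : ∀ {a ℓa} (G : LGroup a ℓa) → IsLHom G G (λ x → x)
id-isLHom G = record { cong = λ p → p ; hom-+ = λ _ _ → refl ; hom-∨ = λ _ _ → refl ; hom-∧ = λ _ _ → refl }
  where open LGroupProperties G using (refl)

-- Multiples of disjoint positive elements stay disjoint. This makes `n` times an ℓ-homomorphism
-- eligible for the uniqueness clause of the tensor product.
·ℕ-isLHom : ∀ {a ℓa} (G : LGroup a ℓa) n → IsLHom G G (LGroup._·ℕ_ G n)
·ℕ-isLHom G n = AdditiveMap.isLHom G G (·ℕ-cong n) (·ℕ-distrib-+ n) (·ℕ-nonneg n) (disjoint-·ℕ n)
  where open LGroupProperties G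

-- Induction over the tensor product.

-- The tensors generate: the ℓ-group terms in tensors, under the equality of their
-- values in T, form an archimedean ℓ-group, and the map T → Term given by the universal
-- property is a section of evaluation because endomorphisms of T fixing tensors are trivial.
module TensorTerms {c ℓ} {G H : LGroup c ℓ} (A : ArchTensor G H) where
  private
    module G = LGroupProperties G
    module H = LGroupProperties H
    module T = LGroupProperties (ArchTensor.T A)
  open ArchTensor A
  open IsLBilinear ⊗-bilinear renaming (cong to ⊗-cong)

  -- The universal property ranges over ℓ-groups at the levels of `G` and `H`. Terms stay in `Set c`
  -- and borrow their equality from `T`, so they form an admissible target.
  data Term : Set c where
    tensor  : G.Carrier → H.Carrier → Term
    0′      : Term
    -′_     : Term → Term
    _+′_ _∨′_ _∧′_ : Term → Term → Term

  eval : Term → T.Carrier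
  eval (tensor x y) = x ⊗ y
  eval 0′           = T.0#
  eval (-′ s)       = T.- eval s
  eval (s +′ t)     = eval s T.+ eval t
  eval (s ∨′ t)     = eval s T.∨ eval t
  eval (s ∧′ t)     = eval s T.∧ eval t

  termLGroup : LGroup c ℓ
  termLGroup = record
    { Carrier = Term
    ; _≈_ = λ s t → eval s T.≈ eval t
    ; _+_ = _+′_ ; 0# = 0′ ; -_ = -′_ ; _∨_ = _∨′_ ; _∧_ = _∧′_
    ; isAbelianGroup = record
      { isGroup = record
        { isMonoid = record
          { isSemigroup = record
            { isMagma = record { isEquivalence = isEquivalence ; ∙-cong = T.+-cong }
            ; assoc = λ _ _ _ → T.+-assoc _ _ _ }
          ; identity = (λ _ → T.+-identityˡ _) , (λ _ → T.+-identityʳ _) }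
        ; inverse = (λ _ → T.-‿inverseˡ _) , (λ _ → T.-‿inverseʳ _)
        ; ⁻¹-cong = T.-‿cong }
      ; comm = λ _ _ → T.+-comm _ _ }
    ; isLattice = record
      { isEquivalence = isEquivalence
      ; ∨-comm = λ _ _ → T.∨-comm _ _
      ; ∨-assoc = λ _ _ _ → T.∨-assoc _ _ _
      ; ∨-cong = T.∨-cong
      ; ∧-comm = λ _ _ → T.∧-comm _ _
      ; ∧-assoc = λ _ _ _ → T.∧-assoc _ _ _
      ; ∧-cong = T.∧-cong
      ; absorptive = (λ _ _ → T.∨-absorbs-∧ _ _) , (λ _ _ → T.∧-absorbs-∨ _ _) }
    ; +-distribˡ-∨ = λ _ _ _ → T.+-distribˡ-∨ _ _ _
    }
    where
    isEquivalence : IsEquivalence (λ s t → eval s T.≈ eval t)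
    isEquivalence = record { refl = T.refl ; sym = T.sym ; trans = T.trans }

  eval-isLHom : IsLHom termLGroup T eval
  eval-isLHom = record
    { cong = λ p → p ; hom-+ = λ _ _ → T.refl ; hom-∨ = λ _ _ → T.refl ; hom-∧ = λ _ _ → T.refl }

  termLGroup-archimedean : Archimedean termLGroup
  termLGroup-archimedean x y h = T-archimedean (eval x) (eval y)
    (λ n → T.≤-trans (T.≤-reflexive (T.sym (LHom.hom-·ℕ termLGroup T eval-isLHom n x))) (h n))

  tensor-bilinear : IsLBilinear G H termLGroup tensor
  tensor-bilinear = record
    { cong = ⊗-cong
    ; additiveˡ = additiveˡ
    ; additiveʳ = additiveʳ
    ; latticeˡ = λ y p → let open IsLHom (latticeˡ y p) in
        record { cong = cong ; hom-+ = hom-+ ; hom-∨ = hom-∨ ; hom-∧ = hom-∧ }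
    ; latticeʳ = λ x p → let open IsLHom (latticeʳ x p) in
        record { cong = cong ; hom-+ = hom-+ ; hom-∨ = hom-∨ ; hom-∧ = hom-∧ }
    }

  term : T.Carrier → Term
  term = proj₁ (universal termLGroup termLGroup-archimedean tensor tensor-bilinear)

  eval-term : ∀ t → eval (term t) T.≈ t
  eval-term t with universal termLGroup termLGroup-archimedean tensor tensor-bilinear
                 | universal T T-archimedean _⊗_ ⊗-bilinear
  ... | ρ , ρ-hom , ρ-⊗ , _ | _ , _ , _ , unique =
    T.trans (unique (λ t → eval (ρ t)) (∘-isLHom eval-isLHom ρ-hom) ρ-⊗ t)
            (T.sym (unique (λ t → t) (id-isLHom T) (λ _ _ → T.refl) t))

  module _ {p} (P : T.Carrier → Set p) (P-resp : ∀ {s t} → s T.≈ t → P s → P t)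
    (P-⊗ : ∀ {x y} → G.0# G.≤ x → H.0# H.≤ y → P (x ⊗ y))
    (P-neg : ∀ {t} → P t → P (T.- t))
    (P-+ : ∀ {s t} → P s → P t → P (s T.+ t))
    (P-∨ : ∀ {s t} → P s → P t → P (s T.∨ t))
    (P-∧ : ∀ {s t} → P s → P t → P (s T.∧ t)) where

    private
      module ⊗ˡ y = AdditiveMap G T {λ x → x ⊗ y} (λ p → ⊗-cong p H.refl) (λ x x′ → additiveˡ x x′ y)
      module ⊗ʳ x = AdditiveMap H T {λ y → x ⊗ y} (λ p → ⊗-cong G.refl p) (additiveʳ x)

      x≈pos-neg : ∀ {x} → G.pos x G.+ G.- G.neg x G.≈ x
      x≈pos-neg {x} = G.trans (G.+-congʳ (G.sym (G.x+neg≈pos x))) (G.x+y-y≈x x _)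

      y≈pos-neg : ∀ {y} → H.pos y H.+ H.- H.neg y H.≈ y
      y≈pos-neg {y} = H.trans (H.+-congʳ (H.sym (H.x+neg≈pos y))) (H.x+y-y≈x y _)

      P-⊗ʳ : ∀ {x} y → G.0# G.≤ x → P (x ⊗ y)
      P-⊗ʳ {x} y 0≤x = P-resp
        (T.trans (T.trans (T.+-congˡ (T.sym (⊗ʳ.f-neg x _))) (T.sym (additiveʳ x _ _)))
                 (⊗-cong G.refl y≈pos-neg))
        (P-+ (P-⊗ 0≤x (H.pos-nonneg y)) (P-neg (P-⊗ 0≤x (H.neg-nonneg y))))

      P-eval : ∀ t → P (eval t)
      P-eval (tensor x y) = P-resp
        (T.trans (T.trans (T.+-congˡ (T.sym (⊗ˡ.f-neg y _))) (T.sym (additiveˡ _ _ y)))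
                 (⊗-cong x≈pos-neg H.refl))
        (P-+ (P-⊗ʳ y (G.pos-nonneg x)) (P-neg (P-⊗ʳ y (G.neg-nonneg x))))
      -- Zero is reached as the positive tensor `0 ⊗ 0`.
      P-eval 0′       = P-resp (⊗ˡ.f-0 H.0#) (P-⊗ G.≤-refl H.≤-refl)
      P-eval (-′ t)   = P-neg (P-eval t)
      P-eval (s +′ t) = P-+ (P-eval s) (P-eval t)
      P-eval (s ∨′ t) = P-∨ (P-eval s) (P-eval t)
      P-eval (s ∧′ t) = P-∧ (P-eval s) (P-eval t)

    -- Positive tensors suffice as base case: splitting each factor into positive minus negative
    -- part writes any tensor through sums and negatives of positive ones. The result for terms is
    -- carried to `t` along `eval-term`.
    tensor-induction : ∀ t → P t
    tensor-induction t = P-resp (eval-term t) (P-eval (term t))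

-- Multiplication in a unital ℓu-ring.

module LURing {c ℓ} (R : LRing c ℓ) (unital : IsUnitalLURing R) where
  open LRing R public using (_*_; 1#; ring; *-positive) renaming (additive to Radd)
  open LGroupProperties Radd
  open Ring ring public using (*-cong; *-assoc; *-identityˡ; *-identityʳ; distribˡ; distribʳ)

  0≤1 : 0# ≤ 1#
  0≤1 = proj₁ unital

  *-nonneg : ∀ {x y} → 0# ≤ x → 0# ≤ y → 0# ≤ x * y
  *-nonneg = *-positive _ _

  module *ˡ x = AdditiveMap Radd Radd {x *_} (*-cong refl) (distribˡ x)
  module *ʳ y = AdditiveMap Radd Radd {_* y} (λ p → *-cong p refl) (λ x x′ → distribʳ y x x′)

  [n·x]y≈n·xy : ∀ n x y → (n ·ℕ x) * y ≈ n ·ℕ (x * y)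
  [n·x]y≈n·xy n x y = *ʳ.f-·ℕ y n x

  *-monoˡ-≤ : ∀ {x y z} → 0# ≤ z → x ≤ y → x * z ≤ y * z
  *-monoˡ-≤ {z = z} 0≤z = *ʳ.f-mono z (λ p → *-nonneg p 0≤z)

  *-monoʳ-≤ : ∀ {x y z} → 0# ≤ z → x ≤ y → z * x ≤ z * y
  *-monoʳ-≤ {z = z} 0≤z = *ˡ.f-mono z (*-nonneg 0≤z)

  -- With `a ≤ n · 1`, the products `a x` and `a y` lie below `n x` and `n y`, which are disjoint
  -- when `x` and `y` are. In a general ℓ-ring multiplication by a positive element need not
  -- preserve meets.
  *ˡ-isLHom : ∀ {a} → 0# ≤ a → IsLHom Radd Radd (a *_)
  *ˡ-isLHom {a} 0≤a = *ˡ.isLHom a (*-nonneg 0≤a)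
    (λ p q d → ≤-trans (∧-greatest (≤-trans (x∧y≤x _ _) (bound p)) (≤-trans (x∧y≤y _ _) (bound q)))
                       (disjoint-·ℕ n p q d))
    where
    n = proj₁ (proj₂ unital a)
    bound : ∀ {x} → 0# ≤ x → a * x ≤ n ·ℕ x
    bound {x} 0≤x = ≤-trans (*-monoˡ-≤ 0≤x (proj₂ (proj₂ unital a)))
      (≤-reflexive (trans ([n·x]y≈n·xy n 1# x) (·ℕ-cong n (*-identityˡ x))))

-- The endomorphisms of the tensor product induced by positive scalars.

module Action {c ℓ} (R : LRing c ℓ) (G : LGroup c ℓ) (unital : IsUnitalLURing R)
              (A : ArchTensor (LRing.additive R) G) where
  private
    module R where
      open LURing R unital public
      open LGroupProperties (LRing.additive R) public
    module G = LGroupProperties G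
    module T = LGroupProperties (ArchTensor.T A)
  open ArchTensor A
  module ⊗ = IsLBilinear ⊗-bilinear
  module ⊗ˡ {y} (0≤y : G.0# G.≤ y) = LHom R.Radd T (⊗.latticeˡ y 0≤y)
  module ⊗ʳ {x} (0≤x : R.0# R.≤ x) = LHom G T (⊗.latticeʳ x 0≤x)

  0≤⊗ : ∀ {x y} → R.0# R.≤ x → G.0# G.≤ y → T.0# T.≤ x ⊗ y
  0≤⊗ 0≤x 0≤y = ⊗ˡ.hom-nonneg 0≤y 0≤x

  -- Taking the positive part makes this ℓ-bilinear for every `a`, so `φ` needs no positivity proof
  -- as an argument.
  scale : R.Carrier → R.Carrier → G.Carrier → T.Carrier
  scale a s g = (R.pos a R.* s) ⊗ g

  scale-bilinear : ∀ a → IsLBilinear R.Radd G T (scale a)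
  scale-bilinear a = record
    { cong = λ p q → ⊗.cong (R.*-cong R.refl p) q
    ; additiveˡ = λ x x′ y → T.trans (⊗.cong (R.distribˡ _ x x′) G.refl) (⊗.additiveˡ _ _ y)
    ; additiveʳ = λ x → ⊗.additiveʳ _
    ; latticeˡ = λ y 0≤y → ∘-isLHom (⊗.latticeˡ y 0≤y) (R.*ˡ-isLHom (R.pos-nonneg a))
    ; latticeʳ = λ x 0≤x → ⊗.latticeʳ _ (R.*-nonneg (R.pos-nonneg a) 0≤x)
    }

  scale-of-nonneg : ∀ {a} → R.0# R.≤ a → ∀ s g → scale a s g T.≈ (a R.* s) ⊗ g
  scale-of-nonneg 0≤a s g = ⊗.cong (R.*-cong (R.pos-of-nonneg 0≤a) R.refl) G.refl

  abstract
    -- Multiplication by a⁺ on T.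
    φ : R.Carrier → T.Carrier → T.Carrier
    φ a = proj₁ (universal T T-archimedean (scale a) (scale-bilinear a))

    φ-isLHom : ∀ a → IsLHom T T (φ a)
    φ-isLHom a = proj₁ (proj₂ (universal T T-archimedean (scale a) (scale-bilinear a)))

    φ-⊗ : ∀ {a} → R.0# R.≤ a → ∀ s g → φ a (s ⊗ g) T.≈ (a R.* s) ⊗ g
    φ-⊗ {a} 0≤a s g = T.trans
      (proj₁ (proj₂ (proj₂ (universal T T-archimedean (scale a) (scale-bilinear a)))) s g)
      (scale-of-nonneg 0≤a s g)

    φ-unique : ∀ {a} → R.0# R.≤ a → ∀ {ψ} → IsLHom T T ψ →
               (∀ s g → ψ (s ⊗ g) T.≈ (a R.* s) ⊗ g) → ∀ t → φ a t T.≈ ψ t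
    φ-unique {a} 0≤a ψ-hom ψ-⊗ t = T.sym
      (proj₂ (proj₂ (proj₂ (universal T T-archimedean (scale a) (scale-bilinear a)))) _ ψ-hom
        (λ s g → T.trans (ψ-⊗ s g) (T.sym (scale-of-nonneg 0≤a s g))) t)

  module φ a = LHom T T (φ-isLHom a)

  φ-1 : ∀ t → φ R.1# t T.≈ t
  φ-1 = φ-unique R.0≤1 (id-isLHom T) (λ s g → ⊗.cong (R.sym (R.*-identityˡ s)) G.refl)

  φ-* : ∀ {a b} → R.0# R.≤ a → R.0# R.≤ b → ∀ t → φ (a R.* b) t T.≈ φ a (φ b t)
  φ-* {a} {b} 0≤a 0≤b = φ-unique (R.*-nonneg 0≤a 0≤b) (∘-isLHom (φ-isLHom a) (φ-isLHom b))
    (λ s g → T.trans (φ.cong a (φ-⊗ 0≤b s g))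
      (T.trans (φ-⊗ 0≤a _ g) (⊗.cong (R.sym (R.*-assoc a b s)) G.refl)))

  ·ℕ-⊗ : ∀ n s g → n T.·ℕ (s ⊗ g) T.≈ (n R.·ℕ s) ⊗ g
  ·ℕ-⊗ n s g = T.sym (AdditiveMap.f-·ℕ R.Radd T (λ p → ⊗.cong p G.refl)
    (λ x x′ → ⊗.additiveˡ x x′ g) n s)

  φ-·ℕ : ∀ n {a} → R.0# R.≤ a → ∀ t → φ (n R.·ℕ a) t T.≈ n T.·ℕ φ a t
  φ-·ℕ n {a} 0≤a = φ-unique (R.·ℕ-nonneg n 0≤a) (∘-isLHom (·ℕ-isLHom T n) (φ-isLHom a))
    (λ s g → T.trans (T.·ℕ-cong n (φ-⊗ 0≤a s g))
      (T.trans (·ℕ-⊗ n _ g) (⊗.cong (R.sym (R.[n·x]y≈n·xy n a s)) G.refl)))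

  φ-n·1 : ∀ n t → φ (n R.·ℕ R.1#) t T.≈ n T.·ℕ t
  φ-n·1 n t = T.trans (φ-·ℕ n R.0≤1 t) (T.·ℕ-cong n (φ-1 t))

  φ-0 : ∀ t → φ R.0# t T.≈ T.0#
  -- The zeroth multiple of `1`: both sides reduce to zero by definition.
  φ-0 = φ-·ℕ 0 R.0≤1

  -- Lipschitz estimates in the scalar.

  -- |φ_r t − φ_s t| ≤ |r − s| ⊗ g, with w standing for |r − s|.
  LipschitzAt : G.Carrier → T.Carrier → Set (c ⊔ ℓ)
  LipschitzAt g t = ∀ {r s w} → R.0# R.≤ r → R.0# R.≤ s → R.0# R.≤ w →
    r R.≤ s R.+ w → s R.≤ r R.+ w → φ r t T.≤ φ s t T.+ w ⊗ g

  Lipschitz : T.Carrier → Set (c ⊔ ℓ)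
  Lipschitz t = ∃ λ g → G.0# G.≤ g × LipschitzAt g t

  LipschitzAt-mono : ∀ {g h t} → g G.≤ h → LipschitzAt g t → LipschitzAt h t
  LipschitzAt-mono g≤h L 0≤r 0≤s 0≤w p q =
    T.≤-trans (L 0≤r 0≤s 0≤w p q) (T.+-monoʳ-≤ _ (⊗ʳ.hom-mono 0≤w g≤h))

  -- On `x ⊗ y` the error is `w x ⊗ y`, and `x ≤ n · 1` bounds it by `n (w ⊗ y) = w ⊗ n y`; hence
  -- the witness `n y`.
  lipschitz-⊗ : ∀ {x y} → R.0# R.≤ x → G.0# G.≤ y → Lipschitz (x ⊗ y)
  lipschitz-⊗ {x} {y} 0≤x 0≤y = n G.·ℕ y , G.·ℕ-nonneg n 0≤y , bound
    where
    n = proj₁ (proj₂ unital x)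
    bound : LipschitzAt (n G.·ℕ y) (x ⊗ y)
    bound {r} {s} {w} 0≤r 0≤s 0≤w p _ = begin
      φ r (x ⊗ y)                          ≈⟨ φ-⊗ 0≤r x y ⟩
      (r R.* x) ⊗ y                        ≤⟨ ⊗ˡ.hom-mono 0≤y (R.*-monoˡ-≤ 0≤x p) ⟩
      ((s R.+ w) R.* x) ⊗ y                ≈⟨ ⊗.cong (R.distribʳ x s w) G.refl ⟩
      (s R.* x R.+ w R.* x) ⊗ y            ≈⟨ ⊗.additiveˡ _ _ y ⟩
      (s R.* x) ⊗ y T.+ (w R.* x) ⊗ y      ≤⟨ T.+-monoʳ-≤ _ (⊗ˡ.hom-mono 0≤y
                                                (R.*-monoʳ-≤ 0≤w (proj₂ (proj₂ unital x)))) ⟩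
      (s R.* x) ⊗ y T.+ (w R.* (n R.·ℕ R.1#)) ⊗ y
        ≈⟨ T.+-cong (T.sym (φ-⊗ 0≤s x y)) (T.trans (⊗.cong (R.trans (R.*ˡ.f-·ℕ w n R.1#)
             (R.·ℕ-cong n (R.*-identityʳ w))) G.refl) (T.sym (·ℕ-⊗ n w y))) ⟩
      φ s (x ⊗ y) T.+ n T.·ℕ (w ⊗ y)       ≈⟨ T.+-congˡ (⊗ʳ.hom-·ℕ 0≤w n y) ⟨
      φ s (x ⊗ y) T.+ w ⊗ (n G.·ℕ y)       ∎
      where open T.≤-Reasoning

  -- Negation reverses the inequality, giving the estimate for `t` with `r` and `s` exchanged. For
  -- this exchange the hypotheses on `w` are symmetric although the conclusion is one-sided.
  lipschitz-neg : ∀ {t} → Lipschitz t → Lipschitz (T.- t)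
  lipschitz-neg {t} (g , 0≤g , L) = g , 0≤g , λ {r} {s} 0≤r 0≤s 0≤w p q →
    T.≤-trans (T.≤-reflexive (φ.hom-neg r t)) (T.≤-trans
      (T.x+z≤y⇒x≤y-z (T.≤-trans (T.≤-reflexive (T.+-comm _ _))
        (T.x≤y+z⇒x-z≤y (T.≤-trans (L 0≤s 0≤r 0≤w q p) (T.≤-reflexive (T.+-comm _ _))))))
      (T.≤-reflexive (T.trans (T.+-comm _ _) (T.+-congʳ (T.sym (φ.hom-neg s t))))))

  lipschitz-+ : ∀ {t t′} → Lipschitz t → Lipschitz t′ → Lipschitz (t T.+ t′)
  lipschitz-+ {t} {t′} (g , 0≤g , L) (g′ , 0≤g′ , L′) = g G.+ g′ , G.+-nonneg 0≤g 0≤g′ ,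
    λ {r} {s} {w} 0≤r 0≤s 0≤w p q → begin
      φ r (t T.+ t′)                            ≈⟨ φ.hom-+ r t t′ ⟩
      φ r t T.+ φ r t′                          ≤⟨ T.+-mono-≤ (L 0≤r 0≤s 0≤w p q) (L′ 0≤r 0≤s 0≤w p q) ⟩
      φ s t T.+ w ⊗ g T.+ (φ s t′ T.+ w ⊗ g′)   ≈⟨ T.+-interchange _ _ _ _ ⟩
      φ s t T.+ φ s t′ T.+ (w ⊗ g T.+ w ⊗ g′)   ≈⟨ T.+-cong (φ.hom-+ s t t′) (⊗.additiveʳ w g g′) ⟨
      φ s (t T.+ t′) T.+ w ⊗ (g G.+ g′)         ∎
    where open T.≤-Reasoning

  -- Raising both constants to `g + g′` gives the two estimates a common error term, which then
  -- bounds the join.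
  lipschitz-∨ : ∀ {t t′} → Lipschitz t → Lipschitz t′ → Lipschitz (t T.∨ t′)
  lipschitz-∨ {t} {t′} (g , 0≤g , L) (g′ , 0≤g′ , L′) = g G.+ g′ , G.+-nonneg 0≤g 0≤g′ ,
    λ {r} {s} 0≤r 0≤s 0≤w p q → T.≤-trans (T.≤-reflexive (φ.hom-∨ r t t′)) (T.∨-least
      (T.≤-trans (LipschitzAt-mono (G.x≤x+y g 0≤g′) L 0≤r 0≤s 0≤w p q)
        (T.+-monoˡ-≤ _ (φ.hom-mono s (T.x≤x∨y t t′))))
      (T.≤-trans (LipschitzAt-mono (G.x≤y+x g′ 0≤g) L′ 0≤r 0≤s 0≤w p q)
        (T.+-monoˡ-≤ _ (φ.hom-mono s (T.y≤x∨y t t′)))))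

  lipschitz-∧ : ∀ {t t′} → Lipschitz t → Lipschitz t′ → Lipschitz (t T.∧ t′)
  lipschitz-∧ {t} {t′} (g , 0≤g , L) (g′ , 0≤g′ , L′) = g G.+ g′ , G.+-nonneg 0≤g 0≤g′ ,
    λ {r} {s} {w} 0≤r 0≤s 0≤w p q → let d = w ⊗ (g G.+ g′) in begin
      φ r (t T.∧ t′)
        ≤⟨ T.∧-greatest
             (T.≤-trans (φ.hom-mono r (T.x∧y≤x t t′))
               (T.≤-trans (LipschitzAt-mono (G.x≤x+y g 0≤g′) L 0≤r 0≤s 0≤w p q)
                 (T.≤-reflexive (T.+-comm _ d))))
             (T.≤-trans (φ.hom-mono r (T.x∧y≤y t t′))
               (T.≤-trans (LipschitzAt-mono (G.x≤y+x g′ 0≤g) L′ 0≤r 0≤s 0≤w p q)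
                 (T.≤-reflexive (T.+-comm _ d)))) ⟩
      (d T.+ φ s t) T.∧ (d T.+ φ s t′)  ≈⟨ T.+-distribˡ-∧ d _ _ ⟨
      d T.+ (φ s t T.∧ φ s t′)          ≈⟨ T.+-comm d _ ⟩
      (φ s t T.∧ φ s t′) T.+ d          ≈⟨ T.+-congʳ (φ.hom-∧ s t t′) ⟨
      φ s (t T.∧ t′) T.+ d              ∎
    where open T.≤-Reasoning

  lipschitz : ∀ t → Lipschitz t
  lipschitz = TensorTerms.tensor-induction A Lipschitz
    (λ {t} {t′} t≈t′ (g , 0≤g , L) → g , 0≤g , λ {r} {s} 0≤r 0≤s 0≤w p q →
      T.≤-trans (T.≤-reflexive (φ.cong r (T.sym t≈t′)))
        (T.≤-trans (L 0≤r 0≤s 0≤w p q) (T.+-monoˡ-≤ _ (T.≤-reflexive (φ.cong s t≈t′)))))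
    lipschitz-⊗ lipschitz-neg lipschitz-+ lipschitz-∨ lipschitz-∧

  -- Additivity of `φ` in the scalar.

  -- The multiples of 1 form a grid of mesh 1: for 0 ≤ x ≤ n, the infimum of |x − k| over
  -- 0 ≤ k ≤ n is at most 1.
  module _ {x X g} (0≤x : R.0# R.≤ x) (0≤g : G.0# G.≤ g)
           (X≤ : ∀ k → X T.≤ R.dist x (k R.·ℕ R.1#) ⊗ g) where

    -- The inequality on `q` says `q ≤ (x − k) ∨ 1`. Each stage meets `q` with the next distance,
    -- and `X ≤ q ⊗ g` survives because tensoring with a positive `g` preserves meets.
    grid-bound : ∀ k → ∃ λ q → q R.+ k R.·ℕ R.1# R.≤ x R.∨ (suc k R.·ℕ R.1#) × X T.≤ q ⊗ g
    -- The start is `x ∨ 1`, which dominates the distance from `x` to `0` since `x` is positive.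
    grid-bound zero = x R.∨ (R.1# R.+ R.0#) , R.≤-reflexive (R.+-identityʳ _) ,
      T.≤-trans (X≤ 0) (⊗ˡ.hom-mono 0≤g (R.x≤y+z⇒x-z≤y (R.≤-trans
        (R.∨-least (R.x≤x∨y x _) (R.≤-trans (R.x≤y+x R.0# R.0≤1) (R.y≤x∨y x _)))
        (R.x≤x+y _ (R.∧-greatest 0≤x R.≤-refl)))))
    grid-bound (suc k) with grid-bound k
    ... | q , q≤ , X≤q⊗g = q R.∧ d ,
      R.grid-step R.0≤1
        (R.≤-trans (R.+-monoˡ-≤ _ (R.x∧y≤x q d)) q≤)
        (R.≤-trans (R.+-monoˡ-≤ _ (R.x∧y≤y q d)) (R.≤-reflexive (R.x-y+y≈x _ _))) ,
      T.≤-trans (T.∧-greatest X≤q⊗g (X≤ (suc k))) (T.≤-reflexive (T.sym (⊗ˡ.hom-∧ 0≤g q d)))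
      where d = R.dist x (suc k R.·ℕ R.1#)

    grid : X T.≤ R.1# ⊗ g
    grid with grid-bound (proj₁ (proj₂ unital x))
    -- At an index `k` with `x ≤ k · 1` the join collapses to `(k + 1) · 1`, and cancelling `k · 1`
    -- leaves `q ≤ 1`.
    ... | q , q≤ , X≤q⊗g = T.≤-trans X≤q⊗g (⊗ˡ.hom-mono 0≤g (R.+-cancelʳ-≤ _
      (R.≤-trans q≤ (R.∨-least (R.≤-trans (proj₂ (proj₂ unital x)) (R.x≤y+x _ R.0≤1)) R.≤-refl))))

  -- The sum is a separate `q` with `q ≈ r + s`, so that the result applies to `m q`, `m r` and
  -- `m s`, where distributivity holds only up to `≈`.
  module AdditivityDefect {t g} (0≤g : G.0# G.≤ g) (L : LipschitzAt g t)
    {r s q} (0≤r : R.0# R.≤ r) (0≤s : R.0# R.≤ s) (q≈r+s : q R.≈ r R.+ s) where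

    defect : T.Carrier
    defect = φ q t T.+ T.- (φ r t T.+ φ s t)

    module Grid (i j : ℕ) where
      I J w v : R.Carrier
      I = i R.·ℕ R.1#
      J = j R.·ℕ R.1#
      w = R.dist r I
      v = R.dist s J

      0≤w : R.0# R.≤ w
      0≤w = R.dist-nonneg r I

      0≤v : R.0# R.≤ v
      0≤v = R.dist-nonneg s J

      0≤q : R.0# R.≤ q
      0≤q = R.≤-trans (R.+-nonneg 0≤r 0≤s) (R.≤-reflexive (R.sym q≈r+s))

      i+j≈I+J : (i ℕ.+ j) R.·ℕ R.1# R.≈ I R.+ J
      i+j≈I+J = R.·ℕ-homo-+ i j R.1#

      q≤ : q R.≤ (i ℕ.+ j) R.·ℕ R.1# R.+ (w R.+ v)
      q≤ = begin
        q                                        ≈⟨ q≈r+s ⟩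
        r R.+ s                                  ≤⟨ R.+-mono-≤ (R.x≤y+dist r I) (R.x≤y+dist s J) ⟩
        (I R.+ w) R.+ (J R.+ v)                  ≈⟨ R.+-interchange I w J v ⟩
        (I R.+ J) R.+ (w R.+ v)                  ≈⟨ R.+-congʳ i+j≈I+J ⟨
        (i ℕ.+ j) R.·ℕ R.1# R.+ (w R.+ v)        ∎
        where open R.≤-Reasoning

      ≤q : (i ℕ.+ j) R.·ℕ R.1# R.≤ q R.+ (w R.+ v)
      ≤q = begin
        (i ℕ.+ j) R.·ℕ R.1#       ≈⟨ i+j≈I+J ⟩
        I R.+ J                   ≤⟨ R.+-mono-≤ (R.y≤x+dist r I) (R.y≤x+dist s J) ⟩
        (r R.+ w) R.+ (s R.+ v)   ≈⟨ R.+-interchange r w s v ⟩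
        (r R.+ s) R.+ (w R.+ v)   ≈⟨ R.+-congʳ q≈r+s ⟨
        q R.+ (w R.+ v)           ∎
        where open R.≤-Reasoning

      -- At integer multiples of `1` the map `φ` is multiplication by an integer, which is additive.
      φ-i+j : φ ((i ℕ.+ j) R.·ℕ R.1#) t T.≈ φ I t T.+ φ J t
      φ-i+j = T.trans (φ-n·1 (i ℕ.+ j) t)
        (T.trans (T.·ℕ-homo-+ i j t) (T.sym (T.+-cong (φ-n·1 i t) (φ-n·1 j t))))

      error : T.Carrier
      error = w ⊗ g T.+ v ⊗ g

      φI+φJ≤ : φ I t T.+ φ J t T.≤ (φ r t T.+ φ s t) T.+ error
      φI+φJ≤ = T.≤-trans
        (T.+-mono-≤
          (L (R.·ℕ-nonneg i R.0≤1) 0≤r 0≤w (R.y≤x+dist r I) (R.x≤y+dist r I))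
          (L (R.·ℕ-nonneg j R.0≤1) 0≤s 0≤v (R.y≤x+dist s J) (R.x≤y+dist s J)))
        (T.≤-reflexive (T.+-interchange (φ r t) (w ⊗ g) (φ s t) (v ⊗ g)))

      error+error : error T.+ error T.≈ w ⊗ (g G.+ g) T.+ v ⊗ (g G.+ g)
      error+error = T.trans (T.+-interchange (w ⊗ g) (v ⊗ g) (w ⊗ g) (v ⊗ g))
        (T.sym (T.+-cong (⊗.additiveʳ w g g) (⊗.additiveʳ v g g)))

      -- Passing from `q` to `i + j` costs one `error`, and passing back from `I`, `J` to `r`, `s`
      -- costs another; the two together double `g`.
      defect≤ : defect T.≤ w ⊗ (g G.+ g) T.+ v ⊗ (g G.+ g)
      defect≤ = T.x≤y+z⇒x-z≤y (begin
        φ q t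
          ≤⟨ L 0≤q (R.·ℕ-nonneg (i ℕ.+ j) R.0≤1) (R.+-nonneg 0≤w 0≤v) q≤ ≤q ⟩
        φ ((i ℕ.+ j) R.·ℕ R.1#) t T.+ (w R.+ v) ⊗ g
          ≈⟨ T.+-cong φ-i+j (⊗.additiveˡ w v g) ⟩
        (φ I t T.+ φ J t) T.+ error
          ≤⟨ T.+-monoˡ-≤ error φI+φJ≤ ⟩
        ((φ r t T.+ φ s t) T.+ error) T.+ error
          ≈⟨ T.+-assoc (φ r t T.+ φ s t) error error ⟩
        (φ r t T.+ φ s t) T.+ (error T.+ error)
          ≈⟨ T.+-comm (φ r t T.+ φ s t) (error T.+ error) ⟩
        (error T.+ error) T.+ (φ r t T.+ φ s t)
          ≈⟨ T.+-congʳ error+error ⟩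
        (w ⊗ (g G.+ g) T.+ v ⊗ (g G.+ g)) T.+ (φ r t T.+ φ s t) ∎)
        where open T.≤-Reasoning

    0≤g+g : G.0# G.≤ g G.+ g
    0≤g+g = G.+-nonneg 0≤g 0≤g

    -- `grid` is applied twice: first over `i` with `j` fixed and the `v` term moved to the left,
    -- then over `j` with the bound just obtained moved to the left.
    defect-bound : defect T.≤ R.1# ⊗ (g G.+ g) T.+ R.1# ⊗ (g G.+ g)
    defect-bound = T.x-z≤y⇒x≤y+z (grid 0≤s 0≤g+g (λ j →
      T.x≤y+z⇒x-z≤y (T.≤-trans
        (T.x-z≤y⇒x≤y+z (grid 0≤r 0≤g+g
          (λ i → T.x≤y+z⇒x-z≤y (Grid.defect≤ i j))))
        (T.≤-reflexive (T.+-comm _ _)))))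

  -- The order of quantifiers matters: `Y` depends on `t` alone and so serves all multiples of `r`
  -- and `s` at once.
  φ-subadditive-bound : ∀ t → ∃ λ Y → ∀ {r s q} → R.0# R.≤ r → R.0# R.≤ s → q R.≈ r R.+ s →
    φ q t T.+ T.- (φ r t T.+ φ s t) T.≤ Y
  φ-subadditive-bound t = let (g , 0≤g , L) = lipschitz t in
    _ , λ 0≤r 0≤s → AdditivityDefect.defect-bound 0≤g L 0≤r 0≤s

  -- Since `φ` commutes with integer multiples, `m` times the defect is the defect of `m r` and
  -- `m s`, which `Y` bounds for every `m`; the archimedean property makes the defect nonpositive.
  φ-subadditive : ∀ {r s q} → R.0# R.≤ r → R.0# R.≤ s → q R.≈ r R.+ s → ∀ t →
    φ q t T.≤ φ r t T.+ φ s t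
  φ-subadditive {r} {s} {q} 0≤r 0≤s q≈r+s t = begin
    φ q t                              ≤⟨ T.x-z≤y⇒x≤y+z (T-archimedean defect Y multiples) ⟩
    T.0# T.+ (φ r t T.+ φ s t)         ≈⟨ T.+-identityˡ _ ⟩
    φ r t T.+ φ s t                    ∎
    where
    open T.≤-Reasoning
    defect Y : T.Carrier
    defect = φ q t T.+ T.- (φ r t T.+ φ s t)
    Y = proj₁ (φ-subadditive-bound t)
    0≤q : R.0# R.≤ q
    0≤q = R.≤-trans (R.+-nonneg 0≤r 0≤s) (R.≤-reflexive (R.sym q≈r+s))
    module _ (m : ℕ) where
      module m = LHom T T (·ℕ-isLHom T m)
      m·defect : m T.·ℕ defect T.≈
        φ (m R.·ℕ q) t T.+ T.- (φ (m R.·ℕ r) t T.+ φ (m R.·ℕ s) t)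
      m·defect = begin-equality
        m T.·ℕ defect
          ≈⟨ m.hom-+ _ _ ⟩
        m T.·ℕ φ q t T.+ m T.·ℕ (T.- (φ r t T.+ φ s t))
          ≈⟨ T.+-congˡ (m.hom-neg _) ⟩
        m T.·ℕ φ q t T.+ T.- (m T.·ℕ (φ r t T.+ φ s t))
          ≈⟨ T.+-congˡ (T.-‿cong (m.hom-+ _ _)) ⟩
        m T.·ℕ φ q t T.+ T.- (m T.·ℕ φ r t T.+ m T.·ℕ φ s t)
          ≈⟨ T.+-cong (φ-·ℕ m 0≤q t) (T.-‿cong (T.+-cong (φ-·ℕ m 0≤r t) (φ-·ℕ m 0≤s t))) ⟨
        φ (m R.·ℕ q) t T.+ T.- (φ (m R.·ℕ r) t T.+ φ (m R.·ℕ s) t) ∎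
      multiples : m T.·ℕ defect T.≤ Y
      multiples = T.≤-trans (T.≤-reflexive m·defect)
        (proj₂ (φ-subadditive-bound t) (R.·ℕ-nonneg m 0≤r) (R.·ℕ-nonneg m 0≤s)
          (R.trans (R.·ℕ-cong m q≈r+s) (R.·ℕ-distrib-+ m r s)))

  -- The reverse inequality is subadditivity at `- t`.
  φ-additive : ∀ {r s q} → R.0# R.≤ r → R.0# R.≤ s → q R.≈ r R.+ s → ∀ t →
    φ q t T.≈ φ r t T.+ φ s t
  φ-additive {r} {s} {q} 0≤r 0≤s q≈r+s t = T.≤-antisym (φ-subadditive 0≤r 0≤s q≈r+s t)
    (T.neg-cancel-≤ (begin
      T.- φ q t                       ≈⟨ φ.hom-neg q t ⟨
      φ q (T.- t)                     ≤⟨ φ-subadditive 0≤r 0≤s q≈r+s (T.- t) ⟩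
      φ r (T.- t) T.+ φ s (T.- t)     ≈⟨ T.+-cong (φ.hom-neg r t) (φ.hom-neg s t) ⟩
      T.- φ r t T.+ T.- φ s t         ≈⟨ T.neg-+ _ _ ⟩
      T.- (φ r t T.+ φ s t)           ∎))
    where open T.≤-Reasoning

  -- The action of arbitrary scalars and the module laws.

  infixr 8 _·_
  _·_ : R.Carrier → T.Carrier → T.Carrier
  r · t = φ (R.pos r) t T.+ T.- φ (R.neg r) t

  -- The action does not depend on how `r` is written as a difference of positives:
  -- `a + neg r ≈ pos r + b`, and `φ` is additive on both sides.
  ·-difference : ∀ {r a b} → R.0# R.≤ a → R.0# R.≤ b → r R.+ b R.≈ a → ∀ t →
    r · t T.+ φ b t T.≈ φ a t
  ·-difference {r} {a} {b} 0≤a 0≤b r+b≈a t = T.+-cancelʳ (φ (R.neg r) t) (begin-equality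
    (r · t T.+ φ b t) T.+ φ (R.neg r) t   ≈⟨ T.xy+z≈xz+y _ _ _ ⟩
    (r · t T.+ φ (R.neg r) t) T.+ φ b t   ≈⟨ T.+-congʳ (T.x-y+y≈x _ _) ⟩
    φ (R.pos r) t T.+ φ b t               ≈⟨ φ-additive (R.pos-nonneg r) 0≤b sum≈ t ⟨
    φ (a R.+ R.neg r) t                   ≈⟨ φ-additive 0≤a (R.neg-nonneg r) R.refl t ⟩
    φ a t T.+ φ (R.neg r) t               ∎)
    where
    open T.≤-Reasoning
    sum≈ : a R.+ R.neg r R.≈ R.pos r R.+ b
    sum≈ = R.trans (R.+-congʳ (R.sym r+b≈a))
      (R.trans (R.xy+z≈xz+y r b _) (R.+-congʳ (R.x+neg≈pos r)))

  -- Module laws are checked in this form: a convenient difference representing `r` reduces them to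
  -- equations without subtraction.
  ·-unique : ∀ {r a b t v} → R.0# R.≤ a → R.0# R.≤ b → r R.+ b R.≈ a →
    v T.+ φ b t T.≈ φ a t → r · t T.≈ v
  ·-unique {b = b} {t} 0≤a 0≤b r+b≈a v+≈ =
    T.+-cancelʳ (φ b t) (T.trans (·-difference 0≤a 0≤b r+b≈a t) (T.sym v+≈))

  ·-pos-neg : ∀ {r t v} → v T.+ φ (R.neg r) t T.≈ φ (R.pos r) t → r · t T.≈ v
  ·-pos-neg {r} = ·-unique (R.pos-nonneg r) (R.neg-nonneg r) (R.x+neg≈pos r)

  pos-neg-· : ∀ r t → r · t T.+ φ (R.neg r) t T.≈ φ (R.pos r) t
  pos-neg-· r t = T.x-y+y≈x _ _

  ·-of-nonneg : ∀ {r} → R.0# R.≤ r → ∀ t → r · t T.≈ φ r t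
  ·-of-nonneg 0≤r t = ·-unique 0≤r R.≤-refl (R.+-identityʳ _)
    (T.trans (T.+-congˡ (φ-0 t)) (T.+-identityʳ _))

  ·-cong : ∀ {r s t t′} → r R.≈ s → t T.≈ t′ → r · t T.≈ s · t′
  ·-cong {r} {s} {t} {t′} r≈s t≈t′ = T.trans
    (T.+-cong (φ.cong _ t≈t′) (T.-‿cong (φ.cong _ t≈t′)))
    -- Congruence in the scalar comes from independence of the decomposition: `pos r` and `neg r`
    -- also represent `s`.
    (·-pos-neg (·-difference (R.pos-nonneg r) (R.neg-nonneg r)
      (R.trans (R.+-congʳ (R.sym r≈s)) (R.x+neg≈pos r)) t′))

  ·-distribʳ : ∀ t r s → (r R.+ s) · t T.≈ r · t T.+ s · t
  ·-distribʳ t r s = ·-unique (R.+-nonneg (R.pos-nonneg r) (R.pos-nonneg s))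
    (R.+-nonneg (R.neg-nonneg r) (R.neg-nonneg s))
    (R.trans (R.+-interchange _ _ _ _) (R.+-cong (R.x+neg≈pos r) (R.x+neg≈pos s)))
    (T.trans (T.+-congˡ (φ-additive (R.neg-nonneg r) (R.neg-nonneg s) R.refl t))
      (T.trans (T.+-interchange _ _ _ _)
        (T.trans (T.+-cong (pos-neg-· r t) (pos-neg-· s t))
          (T.sym (φ-additive (R.pos-nonneg r) (R.pos-nonneg s) R.refl t)))))

  ·-distribˡ : ∀ r s t → r · (s T.+ t) T.≈ r · s T.+ r · t
  ·-distribˡ r s t = ·-pos-neg (T.trans (T.+-congˡ (φ.hom-+ _ s t))
    (T.trans (T.+-interchange _ _ _ _)
      (T.trans (T.+-cong (pos-neg-· r s) (pos-neg-· r t)) (T.sym (φ.hom-+ _ s t)))))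

  ·-zeroˡ : ∀ t → R.0# · t T.≈ T.0#
  ·-zeroˡ t = T.trans (·-of-nonneg R.≤-refl t) (φ-0 t)

  ·-zeroʳ : ∀ r → r · T.0# T.≈ T.0#
  ·-zeroʳ r = ·-pos-neg (T.trans (T.+-identityˡ _) (T.trans (φ.hom-0 _) (T.sym (φ.hom-0 _))))

  ·-identityˡ : ∀ t → R.1# · t T.≈ t
  ·-identityˡ t = T.trans (·-of-nonneg R.0≤1 t) (φ-1 t)

  -- For positive `a`, the products `a * pos s` and `a * neg s` are positive with difference
  -- `a * s`, so `φ-*` applies to each.
  φ-assoc : ∀ {a} → R.0# R.≤ a → ∀ s t → (a R.* s) · t T.≈ φ a (s · t)
  φ-assoc {a} 0≤a s t = ·-unique
    (R.*-nonneg 0≤a (R.pos-nonneg s)) (R.*-nonneg 0≤a (R.neg-nonneg s))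
    (R.trans (R.sym (R.distribˡ a s _)) (R.*-cong R.refl (R.x+neg≈pos s)))
    (T.trans (T.+-congˡ (φ-* 0≤a (R.neg-nonneg s) t))
      (T.trans (T.sym (φ.hom-+ a _ _))
        (T.trans (φ.cong a (pos-neg-· s t)) (T.sym (φ-* 0≤a (R.pos-nonneg s) t)))))

  ·-assoc : ∀ r s t → (r R.* s) · t T.≈ r · (s · t)
  ·-assoc r s t = T.sym (·-pos-neg (begin-equality
    (r R.* s) · t T.+ φ (R.neg r) (s · t)        ≈⟨ T.+-congˡ (φ-assoc (R.neg-nonneg r) s t) ⟨
    (r R.* s) · t T.+ (R.neg r R.* s) · t        ≈⟨ ·-distribʳ t _ _ ⟨
    (r R.* s R.+ R.neg r R.* s) · t              ≈⟨ ·-cong (R.trans (R.sym (R.distribʳ s r _))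
                                                      (R.*-cong (R.x+neg≈pos r) R.refl)) T.refl ⟩
    (R.pos r R.* s) · t                          ≈⟨ φ-assoc (R.pos-nonneg r) s t ⟩
    φ (R.pos r) (s · t)                          ∎))
    where open T.≤-Reasoning

  ·-⊗ : ∀ r s g → r · (s ⊗ g) T.≈ (r R.* s) ⊗ g
  ·-⊗ r s g = ·-pos-neg (begin-equality
    (r R.* s) ⊗ g T.+ φ (R.neg r) (s ⊗ g)    ≈⟨ T.+-congˡ (φ-⊗ (R.neg-nonneg r) s g) ⟩
    (r R.* s) ⊗ g T.+ (R.neg r R.* s) ⊗ g    ≈⟨ ⊗.additiveˡ _ _ g ⟨
    (r R.* s R.+ R.neg r R.* s) ⊗ g          ≈⟨ ⊗.cong (R.trans (R.sym (R.distribʳ s r _))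
                                                  (R.*-cong (R.x+neg≈pos r) R.refl)) G.refl ⟩
    (R.pos r R.* s) ⊗ g                      ≈⟨ φ-⊗ (R.pos-nonneg r) s g ⟨
    φ (R.pos r) (s ⊗ g)                      ∎)
    where open T.≤-Reasoning

  ·-isLeftModule : IsLeftModule R.ring T._≈_ T._+_ T.0# T.-_ _·_
  ·-isLeftModule = record
    { isLeftSemimodule = record
      { +ᴹ-isCommutativeMonoid = IsAbelianGroup.isCommutativeMonoid T.isAbelianGroup
      ; isPreleftSemimodule = record
        { *ₗ-cong = ·-cong
        ; *ₗ-zeroˡ = ·-zeroˡ
        ; *ₗ-distribʳ = ·-distribʳ
        ; *ₗ-identityˡ = ·-identityˡ
        ; *ₗ-assoc = ·-assoc
        ; *ₗ-zeroʳ = ·-zeroʳ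
        ; *ₗ-distribˡ = ·-distribˡ
        }
      }
    ; -ᴹ‿cong = T.-‿cong
    ; -ᴹ‿inverse = T.-‿inverseˡ , T.-‿inverseʳ
    }

  -- The strong unit and the conclusion.

  1⊗u-isStrongUnit : ∀ {u} → IsStrongUnit G u → IsStrongUnit T (R.1# ⊗ u)
  1⊗u-isStrongUnit {u} (0≤u , u-bounds) = 0≤⊗ R.0≤1 0≤u , bounded
    where
    open T.≤-Reasoning
    bounded : ∀ t → ∃ λ n → t T.≤ n T.·ℕ (R.1# ⊗ u)
    bounded t = n , (begin
      t                            ≈⟨ φ-1 t ⟨
      -- The estimate is taken at `r = 1`, `s = 0`, `w = 1`; its constant `g` is then bounded by a
      -- multiple of `u`.
      φ R.1# t                     ≤⟨ L R.0≤1 R.≤-refl R.0≤1 (R.x≤y+x R.1# R.≤-refl)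
                                        (R.+-nonneg R.0≤1 R.0≤1) ⟩
      φ R.0# t T.+ R.1# ⊗ g        ≈⟨ T.+-congʳ (φ-0 t) ⟩
      T.0# T.+ R.1# ⊗ g            ≈⟨ T.+-identityˡ _ ⟩
      R.1# ⊗ g                     ≤⟨ ⊗ʳ.hom-mono R.0≤1 (proj₂ (u-bounds g)) ⟩
      R.1# ⊗ (n G.·ℕ u)            ≈⟨ ⊗ʳ.hom-·ℕ R.0≤1 n u ⟩
      n T.·ℕ (R.1# ⊗ u)            ∎)
      where
      g : G.Carrier
      g = proj₁ (lipschitz t)
      L : LipschitzAt g t
      L = proj₂ (proj₂ (lipschitz t))
      n : ℕ
      n = proj₁ (u-bounds g)

  ·-isLUModule : ∀ {u} → IsStrongUnit G u → IsLUModule R T _·_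
  ·-isLUModule {u} u-strong = record
    { isLeftModule = ·-isLeftModule
    ; positive-∨ = λ r 0≤r x y → T.trans (·-of-nonneg 0≤r _) (T.trans (φ.hom-∨ r x y)
        (T.sym (T.∨-cong (·-of-nonneg 0≤r x) (·-of-nonneg 0≤r y))))
    ; positive-∧ = λ r 0≤r x y → T.trans (·-of-nonneg 0≤r _) (T.trans (φ.hom-∧ r x y)
        (T.sym (T.∧-cong (·-of-nonneg 0≤r x) (·-of-nonneg 0≤r y))))
    ; positive-cone = λ r x 0≤r 0≤x → T.≤-trans (φ.hom-nonneg r 0≤x)
        (T.≤-reflexive (T.sym (·-of-nonneg 0≤r x)))
    ; strongUnit = R.1# ⊗ u , 1⊗u-isStrongUnit u-strong
    }

theorem3p7 : ∀ {c ℓ} (R : LRing c ℓ) (G : LGroup c ℓ) →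
    IsUnitalLURing R → Archimedean (LRing.additive R) →
    (u : LGroup.Carrier G) → IsStrongUnit G u → Archimedean G →
    (A : ArchTensor (LRing.additive R) G) →
    Σ (LRing.Carrier R → LGroup.Carrier (ArchTensor.T A) → LGroup.Carrier (ArchTensor.T A))
      (λ _·_ → IsLUModule R (ArchTensor.T A) _·_ ×
        (∀ r s g → LGroup._≈_ (ArchTensor.T A) (r · ArchTensor._⊗_ A s g)
                     (ArchTensor._⊗_ A (LRing._*_ R r s) g)))
theorem3p7 R G unital _ u u-strong _ A = _·_ , ·-isLUModule u-strong , ·-⊗
  where open Action R G unital A
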